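{- Let $(X,S)$ be a thin coherent configuration, with associated monoid $(S,\nabla,e)$ in $\mathbf{Mat}_{\mathbb R_0^+}$. Then the monoid $(R(S),R(\nabla),R(e))$ in $\mathbf{Rel}$ is a groupoid; that is, the relation $R(\nabla)\colon S\times S\to S$ is a partial binary operation on $S$ which is the composition of a groupoid whose set of morphisms is $S$ and whose set of identity morphisms is the subset of $S$ selected by $R(e)$.
   Context: $\mathbf{Mat}_{\mathbb R_0^+}$ is the category whose objects are finite sets and whose morphisms $X\to Y$ are non-negative real matrices with entries $f_x^y$, composed by matrix multiplication, monoidal via cartesian product of sets and Kronecker product of matrices, with unit object $I=\{*\}$. The functor $R\colon \mathbf{Mat}_{\mathbb R_0^+}\to\mathbf{Rel}$ to sets and relations is the identity on objects and sends $f\colon A\to B$ to the relation $\{(a,b): f_a^b>0\}$; it is strictly monoidal. A coherent configuration $(X,S)$ is a finite set $X$ with a partition $S$ of $X\times X$ such that: if $p\in S$ contains some $(x,x)$ then $p\subseteq\mathrm{id}_X$; for $a,b,c\in S$ the number $\nabla_{ab}^c$ of $z\in X$ with $(x,z)\in a$, $(z,y)\in b$ is the same for all $(x,y)\in c$; and $c\in S$ implies $c^{ -1}=\{(y,x):(x,y)\in c\}\in S$. The valency $\|a\|$ of $a\in S$ is the number of $y\in X$ with $(x,y)\in a$, for any $x$ for which at least one such $y$ exists. $(X,S)$ is thin if $\|a\|=1$ for all $a\in S$. The associated monoid is $(S,\nabla,e)$ with $\nabla\colon S\otimes S\to S$ the matrix of the $\nabla_{ab}^c$ and $e\colon I\to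 S$ with $e_*^a=1$ if $a\subseteq\mathrm{id}_X$ and $0$ otherwise. A groupoid is a category in which every morphism is invertible. A small groupoid is regarded as a monoid in $\mathbf{Rel}$ on its set of morphisms $G_1$: the multiplication relation $G_1\times G_1\to G_1$ is the partial operation of composition, and the unit relation $\{*\}\to G_1$ selects the set of identity morphisms. -}

module Defs where

open import Data.Bool.Base using (if_then_else_)
open import Data.Fin.Base using (Fin)
open import Data.Fin.Properties using (*↔×; 1↔⊤; all?)
import Data.Fin.Properties as Fin
open import Data.Integer.Base using (+_)
open import Data.List.Base using (List; tabulate; filter; length)
open import Data.Nat.Base using (ℕ; suc)
open import Data.Product.Base using (Σ; ∃; _×_; _,_; proj₁; proj₂; swap)
open import Data.Product.Function.NonDependent.Propositional using (_×-↔_)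
open import Data.Rational.Unnormalised.Base
  using (ℚᵘ; ∣_∣; _+_; _-_; -_; _/_; _≤_; _<_)
open import Data.Rational.Unnormalised.Properties
  using (≤-reflexive; ≤-trans; ∣-∣-cong; +-inverseʳ; nonNegative⁻¹; nonPositive⁻¹)
open import Data.Unit.Base using (⊤)
open import Function.Base using (_∘_)
open import Function.Bundles using (_↔_; Inverse)
open import Function.Construct.Composition using (_↔-∘_)
open import Function.Properties.Inverse using (↔-sym; ↔⇒↣)
open import Level using (0ℓ)
open import Relation.Binary.Core using (REL; _⇔_)
open import Relation.Binary.Definitions using (DecidableEquality)
open import Relation.Binary.PropositionalEquality using (_≡_; subst)
open import Relation.Nullary.Decidable
  using (Dec; does; map′; via-injection; _×-dec_; _→-dec_)
open import Relation.Unary using (Pred; Decidable; Satisfiable; _∈_; _⊆_; _≐_; _⊢_)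

-- The reals, as Bishop's regular Cauchy sequences of rationals: `seq n` lies
-- within 1/(n+1) of the number represented.

ε[_] : ℕ → ℚᵘ
ε[ n ] = + 1 / suc n

record ℝ : Set where
  field
    seq     : ℕ → ℚᵘ
    regular : ∀ m n → ∣ seq m - seq n ∣ ≤ ε[ m ] + ε[ n ]

open ℝ

NonNeg : Pred ℝ 0ℓ
NonNeg x = ∀ n → - ε[ n ] ≤ seq x n

Pos : Pred ℝ 0ℓ
Pos x = ∃ λ n → ε[ n ] < seq x n

ℝ₀⁺ : Set
ℝ₀⁺ = Σ ℝ NonNeg

_>0 : Pred ℝ₀⁺ 0ℓ
(x , _) >0 = Pos x

fromℕ : ℕ → ℝ₀⁺
fromℕ k = record { seq = λ _ → + k / 1 ; regular = reg } , λ n →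
  ≤-trans (nonPositive⁻¹ (- ε[ n ])) (nonNegative⁻¹ (+ k / 1))
  where
  reg : ∀ m n → ∣ + k / 1 - + k / 1 ∣ ≤ ε[ m ] + ε[ n ]
  reg m n = ≤-trans (≤-reflexive (∣-∣-cong (+-inverseʳ (+ k / 1))))
                    (nonNegative⁻¹ (ε[ m ] + ε[ n ]))

record FinSet : Set₁ where
  field
    Carrier : Set
    size    : ℕ
    enum    : Fin size ↔ Carrier

  elements : List Carrier
  elements = tabulate (Inverse.to enum)

  count : {P : Pred Carrier 0ℓ} → Decidable P → ℕ
  count P? = length (filter P? elements)

  _≟_ : DecidableEquality Carrier
  _≟_ = via-injection (↔⇒↣ (↔-sym enum)) Fin._≟_

  forall? : {P : Pred Carrier 0ℓ} → Decidable P → Dec (∀ x → P x)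
  forall? {P} P? = map′
    (λ h x → subst P (Inverse.strictlyInverseˡ enum x) (h (Inverse.from enum x)))
    (λ h i → h (Inverse.to enum i))
    (all? (P? ∘ Inverse.to enum))

open FinSet public using (Carrier)

I : FinSet
I = record { Carrier = ⊤ ; size = 1 ; enum = 1↔⊤ }

infixr 7 _⊗_
_⊗_ : FinSet → FinSet → FinSet
X ⊗ Y = record
  { Carrier = Carrier X × Carrier Y
  ; enum    = (FinSet.enum X ×-↔ FinSet.enum Y) ↔-∘ *↔×
  }

-- Morphisms X → Y of Mat; the entry f_x^y is f x y.
Mat : FinSet → FinSet → Set
Mat X Y = Carrier X → Carrier Y → ℝ₀⁺

R : ∀ {X Y} → Mat X Y → REL (Carrier X) (Carrier Y) 0ℓ
R f a b = f a b >0

-- A partition of A whose set of blocks is S.  By `disjoint` and `nonempty`,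
-- distinct elements of S name distinct subsets of A.
record Partition (A S : Set) : Set₁ where
  field
    Block    : S → Pred A 0ℓ
    nonempty : ∀ a → Satisfiable (Block a)
    disjoint : ∀ {a b p} → p ∈ Block a → p ∈ Block b → a ≡ b
    cover    : ∀ p → ∃ λ a → p ∈ Block a

Diagonal : {A : Set} → Pred (A × A) 0ℓ
Diagonal (x , y) = x ≡ y

module PartitionOfSquare
  (X S : FinSet) (P : Partition (Carrier X × Carrier X) (Carrier S)) where

  open Partition P

  block? : ∀ a → Decidable (Block a)
  block? a p with cover p
  ... | b , p∈b = map′ (λ b≡a → subst (λ c → p ∈ Block c) b≡a p∈b)
                       (disjoint p∈b)
                       (FinSet._≟_ S b a)

  ⊆diagonal? : ∀ a → Dec (∀ x y → (x , y) ∈ Block a → x ≡ y)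
  ⊆diagonal? a = FinSet.forall? X λ x → FinSet.forall? X λ y →
    block? a (x , y) →-dec FinSet._≟_ X x y

  #intermediate : (a b : Carrier S) → Carrier X × Carrier X → ℕ
  #intermediate a b (x , y) =
    FinSet.count X λ z → block? a (x , z) ×-dec block? b (z , y)

  #successors : Carrier S → Carrier X → ℕ
  #successors a x = FinSet.count X λ y → block? a (x , y)

record CoherentConfiguration (X : FinSet) : Set₁ where
  field
    S         : FinSet
    partition : Partition (Carrier X × Carrier X) (Carrier S)

  open Partition partition public
  open PartitionOfSquare X S partition public

  field
    diagonal : ∀ {a x} → (x , x) ∈ Block a → Block a ⊆ Diagonal
    coherent : ∀ a b c {p q} → p ∈ Block c → q ∈ Block c →
               #intermediate a b p ≡ #intermediate a b q
    converse : ∀ c → ∃ λ c′ → Block c′ ≐ (swap ⊢ Block c)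

  -- ∇_{ab}^c, evaluated at some pair in c; by `coherent` the choice of pair
  -- is immaterial.
  structureConstant : (a b c : Carrier S) → ℕ
  structureConstant a b c = #intermediate a b (proj₁ (nonempty c))

  ∇ : Mat (S ⊗ S) S
  ∇ (a , b) c = fromℕ (structureConstant a b c)

  e : Mat I S
  e _ a = fromℕ (if does (⊆diagonal? a) then 1 else 0)

  -- Evaluated at the first component of some pair in a.  The axioms imply that
  -- the count is the same at every x that has a successor under a.
  ‖_‖ : Carrier S → ℕ
  ‖ a ‖ = #successors a (proj₁ (proj₁ (nonempty a)))

  Thin : Set
  Thin = ∀ a → ‖ a ‖ ≡ 1

-- Small categories whose set of all morphisms is Mor.  Composition is written
-- in diagrammatic order: f ⨾ g is f followed by g.  The map id embeds Obj as a
-- retract of Mor, so when Mor has decidable equality (as any finite set does),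
-- so does Obj, and f ⨾ g does not depend on the proof of composability.
record Category (Mor : Set) : Set₁ where
  field
    Obj     : Set
    dom cod : Mor → Obj
    id      : Obj → Mor
    _⨾_⟨_⟩  : (f g : Mor) → cod f ≡ dom g → Mor

    dom-id : ∀ A → dom (id A) ≡ A
    cod-id : ∀ A → cod (id A) ≡ A
    dom-⨾  : ∀ {f g} (p : cod f ≡ dom g) → dom (f ⨾ g ⟨ p ⟩) ≡ dom f
    cod-⨾  : ∀ {f g} (p : cod f ≡ dom g) → cod (f ⨾ g ⟨ p ⟩) ≡ cod g

    identityˡ : ∀ {f} (p : cod (id (dom f)) ≡ dom f) → id (dom f) ⨾ f ⟨ p ⟩ ≡ f
    identityʳ : ∀ {f} (p : cod f ≡ dom (id (cod f))) → f ⨾ id (cod f) ⟨ p ⟩ ≡ f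
    assoc     : ∀ {f g h}
                (p : cod f ≡ dom g) (q : cod (f ⨾ g ⟨ p ⟩) ≡ dom h)
                (r : cod g ≡ dom h) (s : cod f ≡ dom (g ⨾ h ⟨ r ⟩)) →
                (f ⨾ g ⟨ p ⟩) ⨾ h ⟨ q ⟩ ≡ f ⨾ (g ⨾ h ⟨ r ⟩) ⟨ s ⟩

  Invertible : Pred Mor 0ℓ
  Invertible f = Σ Mor λ g →
    Σ (cod f ≡ dom g) λ p → Σ (cod g ≡ dom f) λ q →
    f ⨾ g ⟨ p ⟩ ≡ id (dom f) × g ⨾ f ⟨ q ⟩ ≡ id (cod f)

record Groupoid (Mor : Set) : Set₁ where
  field
    category   : Category Mor
    invertible : ∀ f → Category.Invertible category f

  open Category category public

  multiplication : REL (Mor × Mor) Mor 0ℓ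
  multiplication (f , g) h = Σ (cod f ≡ dom g) λ p → f ⨾ g ⟨ p ⟩ ≡ h

  unit : REL ⊤ Mor 0ℓ
  unit _ f = ∃ λ A → id A ≡ f

IsPartialFunction : {A B : Set} → REL A B 0ℓ → Set
IsPartialFunction ρ = ∀ {x y z} → ρ x y → ρ x z → y ≡ z

-- A monoid in Rel on the set M, given by its multiplication and unit relations,
-- that is the one associated with a groupoid.
IsGroupoid : (M : Set) → REL (M × M) M 0ℓ → REL ⊤ M 0ℓ → Set₁
IsGroupoid M μ η =
  IsPartialFunction μ ×
  Σ (Groupoid M) λ G → (μ ⇔ Groupoid.multiplication G) × (η ⇔ Groupoid.unit G)

{-# OPTIONS --safe #-}

-- Write ι x for the block of (x , x).  Coherence says that whether a pair (x , y) factors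
-- through a and b depends only on the block of (x , y); applied with a diagonal
-- or a converse block, this shows that the block of (x , y) determines ι x and ι y,
-- and that a block a has a successor at every x with the right ι x.  Thinness
-- makes that successor unique, so blocks compose like partial injections: the
-- objects of the groupoid are the diagonal blocks, and the inverse of a block
-- is its converse.

module Submission where

open import Defs

open import Data.Bool.Base using (if_then_else_)
open import Data.Bool.Properties using (T-irrelevant)
open import Data.Integer.Base using (+<+)
open import Data.List.Base using (List; []; _∷_; length)
open import Data.List.Membership.Propositional using (_∈_)
open import Data.List.Membership.Propositional.Properties
  using (∈-filter⁺; ∈-filter⁻; ∈-tabulate⁺; ∈-length)
open import Data.List.Relation.Unary.Any using (here)
open import Data.Nat.Base using (suc; _<_; z≤n; s≤s)
open import Data.Product.Base using (Σ; ∃; ∃₂; _×_; _,_; proj₁; proj₂)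
open import Data.Rational.Unnormalised.Base using (*<*)
open import Function.Bundles using (Inverse)
open import Level using (0ℓ)
open import Relation.Binary.PropositionalEquality
  using (_≡_; refl; sym; trans; cong; subst)
open import Relation.Nullary.Decidable
  using (Dec; yes; no; does; True; toWitness; fromWitness)
open import Relation.Unary using (Pred; Decidable; Satisfiable)

-- Positivity of natural-number matrix entries

0<⇒fromℕ>0 : ∀ {n} → 0 < n → fromℕ n >0
0<⇒fromℕ>0 {suc n} _ = 1 , *<* (+<+ (s≤s (s≤s z≤n)))

fromℕ>0⇒0< : ∀ {n} → fromℕ n >0 → 0 < n
fromℕ>0⇒0< {0}     (_ , *<* (+<+ ()))
fromℕ>0⇒0< {suc n} _ = s≤s z≤n

indicator>0⇒True : {A : Set} (a? : Dec A) →
                   fromℕ (if does a? then 1 else 0) >0 → True a?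
indicator>0⇒True (yes _) _                   = _
indicator>0⇒True (no _)  (_ , *<* (+<+ ()))

True⇒indicator>0 : {A : Set} (a? : Dec A) →
                   True a? → fromℕ (if does a? then 1 else 0) >0
True⇒indicator>0 (yes _) _ = 0<⇒fromℕ>0 (s≤s z≤n)

0<length⇒∃∈ : {A : Set} {xs : List A} → 0 < length xs → ∃ λ x → x ∈ xs
0<length⇒∃∈ {xs = x ∷ _} _ = x , here refl

length≡1⇒∈-unique : {A : Set} {xs : List A} {x y : A} →
                    length xs ≡ 1 → x ∈ xs → y ∈ xs → x ≡ y
length≡1⇒∈-unique {xs = _ ∷ []} _ (here refl) (here refl) = refl

-- Counting in a finite set

module _ (X : FinSet) where
  open FinSet X using (enum; elements; count)

  ∈-elements : ∀ x → x ∈ elements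
  ∈-elements x = subst (_∈ elements) (Inverse.strictlyInverseˡ enum x)
                       (∈-tabulate⁺ (Inverse.from enum x))

  module _ {P : Pred (Carrier X) 0ℓ} (P? : Decidable P) where

    satisfiable⇒0<count : Satisfiable P → 0 < count P?
    satisfiable⇒0<count (x , px) = ∈-length (∈-filter⁺ P? (∈-elements x) px)

    0<count⇒satisfiable : 0 < count P? → Satisfiable P
    0<count⇒satisfiable 0<n with 0<length⇒∃∈ 0<n
    ... | x , x∈ = x , proj₂ (∈-filter⁻ P? {xs = elements} x∈)

    count≡1⇒unique : count P? ≡ 1 → ∀ {x y} → P x → P y → x ≡ y
    count≡1⇒unique n≡1 {x} {y} px py = length≡1⇒∈-unique n≡1
      (∈-filter⁺ P? (∈-elements x) px) (∈-filter⁺ P? (∈-elements y) py)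

-- Consequences of coherence

module Coherent {X : FinSet} (C : CoherentConfiguration X) where
  open CoherentConfiguration C

  private
    variable
      a b c : Carrier S
      x y z x′ y′ z′ : Carrier X

  infix 4 _-[_]→_
  _-[_]→_ : Carrier X → Carrier S → Carrier X → Set
  x -[ a ]→ y = Block a (x , y)

  Factors : (a b : Carrier S) (x y : Carrier X) → Set
  Factors a b x y = ∃ λ z → x -[ a ]→ z × z -[ b ]→ y

  abstract
    Factors⇒0<#intermediate : Factors a b x y → 0 < #intermediate a b (x , y)
    Factors⇒0<#intermediate = satisfiable⇒0<count X _

    0<#intermediate⇒Factors : 0 < #intermediate a b (x , y) → Factors a b x y
    0<#intermediate⇒Factors = 0<count⇒satisfiable X _

    Factors-resp : x -[ c ]→ y → x′ -[ c ]→ y′ → Factors a b x y → Factors a b x′ y′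
    Factors-resp {a = a} {b = b} p q f = 0<#intermediate⇒Factors
      (subst (0 <_) (coherent a b _ p q) (Factors⇒0<#intermediate f))

  _ᵒ : Carrier S → Carrier S
  a ᵒ = proj₁ (converse a)

  ᵒ⁺ : x -[ a ]→ y → y -[ a ᵒ ]→ x
  ᵒ⁺ {a = a} = proj₂ (proj₂ (converse a))

  ᵒ⁻ : y -[ a ᵒ ]→ x → x -[ a ]→ y
  ᵒ⁻ {a = a} = proj₁ (proj₂ (converse a))

  block : Carrier X → Carrier X → Carrier S
  block x y = proj₁ (cover (x , y))

  ∈block : x -[ block x y ]→ y
  ∈block = proj₂ (cover _)

  source target : Carrier S → Carrier X
  source a = proj₁ (proj₁ (nonempty a))
  target a = proj₂ (proj₁ (nonempty a))

  ∈nonempty : source a -[ a ]→ target a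
  ∈nonempty {a} = proj₂ (nonempty a)

  -- `True` of a decision is proof-irrelevant, so equality of objects is equality of the underlying
  -- blocks.
  Obj : Set
  Obj = Σ (Carrier S) λ a → True (⊆diagonal? a)

  Obj-≡ : {A B : Obj} → proj₁ A ≡ proj₁ B → A ≡ B
  Obj-≡ {a , t} {_ , u} refl = cong (a ,_) (T-irrelevant t u)

  Obj-diagonal : (A : Obj) → x -[ proj₁ A ]→ y → x ≡ y
  Obj-diagonal (_ , t) = toWitness t _ _

  ι : Carrier X → Obj
  ι x = block x x , fromWitness λ _ _ → diagonal ∈block

  ∈ι⇒≡ : x -[ proj₁ (ι y) ]→ x → ι x ≡ ι y
  ∈ι⇒≡ p = Obj-≡ (disjoint ∈block p)

  -- The pair (x′ , y′) factors through `ι x′` and `a`, hence so does (x , y); as `ι x′` is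
  -- diagonal, the intermediate point is x itself, so (x , x) lies in `ι x′`.
  ι-source : x -[ a ]→ y → x′ -[ a ]→ y′ → ι x ≡ ι x′
  ι-source {x = x} {x′ = x′} p q with Factors-resp q p (x′ , ∈block , q)
  ... | z , x→z , _ with Obj-diagonal (ι x′) x→z
  ...   | refl = ∈ι⇒≡ x→z

  ι-target : x -[ a ]→ y → x′ -[ a ]→ y′ → ι y ≡ ι y′
  ι-target p q = ι-source (ᵒ⁺ p) (ᵒ⁺ q)

  -- The loop (x , x) factors through `a` and `a ᵒ`, and (x′ , x′) lies in the same block, so it
  -- factors as well.
  successor : ι x ≡ ι x′ → x -[ a ]→ y → ∃ λ y′ → x′ -[ a ]→ y′
  successor {x′ = x′} {y = y} eq p
    with Factors-resp ∈block
           (subst (λ A → x′ -[ proj₁ A ]→ x′) (sym eq) ∈block)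
           (y , p , ᵒ⁺ p)
  ... | y′ , q , _ = y′ , q

  dom cod : Carrier S → Obj
  dom a = ι (source a)
  cod a = ι (target a)

  dom-∈ : x -[ a ]→ y → dom a ≡ ι x
  dom-∈ = ι-source ∈nonempty

  cod-∈ : x -[ a ]→ y → cod a ≡ ι y
  cod-∈ = ι-target ∈nonempty

  ∈-Obj : (A : Obj) → x -[ proj₁ A ]→ y → x -[ proj₁ A ]→ x
  ∈-Obj A p with Obj-diagonal A p
  ... | refl = p

  dom-id : ∀ A → dom (proj₁ A) ≡ A
  dom-id A = Obj-≡ (disjoint ∈block (∈-Obj A ∈nonempty))

  cod-id : ∀ A → cod (proj₁ A) ≡ A
  cod-id A = trans (cong ι (sym (Obj-diagonal A ∈nonempty))) (dom-id A)

  cod≡dom : x -[ a ]→ y → y -[ b ]→ z → cod a ≡ dom b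
  cod≡dom p q = trans (cod-∈ p) (sym (dom-∈ q))

  abstract
    extend : x -[ a ]→ y → cod a ≡ dom b → ∃ λ z → y -[ b ]→ z
    extend p eq = successor (trans (sym eq) (cod-∈ p)) ∈nonempty

  -- The block spanned by one particular path through `a` and `b`; independence of the path needs
  -- thinness and comes from `composite-unique`.
  compose : (a b : Carrier S) → cod a ≡ dom b → Carrier S
  compose a b eq = block (source a) (proj₁ (extend {b = b} (∈nonempty {a}) eq))

  -- The groupoid of a thin configuration

  module ThinGroupoid (thin : Thin) where

    -- At `source a` this is thinness; any other x -[ a ]→ y reduces to it
    -- by factoring (x , y′) through a and the block of (y , y′).
    functional : x -[ a ]→ y → x -[ a ]→ y′ → y ≡ y′
    functional {a = a} {y = y} p q with Factors-resp q (∈nonempty {a}) (y , p , ∈block)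
    ... | z , s→z , z→t with count≡1⇒unique X _ (thin a) s→z ∈nonempty
    ...   | refl = diagonal z→t ∈block

    -- (x′ , y′) factors through c and bᵒ, hence so does (x , y).
    composite-unique : x′ -[ a ]→ y′ → y′ -[ b ]→ z′ → x′ -[ c ]→ z′ →
                       x -[ a ]→ y → y -[ b ]→ z → x -[ c ]→ z
    composite-unique p′ q′ r′ p q with Factors-resp p′ p (_ , r′ , ᵒ⁺ q′)
    ... | w , r , q″ with functional q (ᵒ⁻ q″)
    ...   | refl = r

    ∈compose : (eq : cod a ≡ dom b) → x -[ a ]→ y → y -[ b ]→ z →
               x -[ compose a b eq ]→ z
    ∈compose eq = composite-unique ∈nonempty (proj₂ (extend ∈nonempty eq)) ∈block

    -- Reduces each groupoid law to exhibiting a single triangle of points, since blocks that share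
    -- a pair coincide.
    compose-≡ : (eq : cod a ≡ dom b) → x -[ a ]→ y → y -[ b ]→ z →
                x -[ c ]→ z → compose a b eq ≡ c
    compose-≡ eq p q = disjoint (∈compose eq p q)

    compose-factors : (eq : cod a ≡ dom b) →
                      ∃₂ λ x z → Factors a b x z × x -[ compose a b eq ]→ z
    compose-factors eq = _ , _ , (_ , ∈nonempty , proj₂ (extend ∈nonempty eq)) , ∈block

    compose-assoc : ∀ {f g h} (p : cod f ≡ dom g) (q : cod (compose f g p) ≡ dom h)
                    (r : cod g ≡ dom h) (s : cod f ≡ dom (compose g h r)) →
                    compose (compose f g p) h q ≡ compose f (compose g h r) s
    compose-assoc p q r s =
      -- Both bracketings contain the pair of endpoints of one path x → y → z → w.
      let x→y     = ∈nonempty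
          _ , y→z = extend x→y p
          _ , z→w = extend y→z r
      in compose-≡ q (∈compose p x→y y→z) z→w (∈compose s x→y (∈compose r y→z z→w))

    category : Category (Carrier S)
    category = record
      { Obj       = Obj
      ; dom       = dom
      ; cod       = cod
      ; id        = proj₁
      ; _⨾_⟨_⟩    = compose
      ; dom-id    = dom-id
      ; cod-id    = cod-id
      ; dom-⨾     = dom-compose
      ; cod-⨾     = cod-compose
      -- Degenerate triangles for the unit laws: the source, respectively the target, of the chosen
      -- pair is repeated.
      ; identityˡ = λ p → compose-≡ p ∈block ∈nonempty ∈nonempty
      ; identityʳ = λ p → compose-≡ p ∈nonempty ∈block ∈nonempty
      ; assoc     = compose-assoc
      }
      where
      dom-compose : (eq : cod a ≡ dom b) → dom (compose a b eq) ≡ dom a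
      dom-compose eq with compose-factors eq
      ... | _ , _ , (_ , p , _) , r = trans (dom-∈ r) (sym (dom-∈ p))

      cod-compose : (eq : cod a ≡ dom b) → cod (compose a b eq) ≡ cod b
      cod-compose eq with compose-factors eq
      ... | _ , _ , (_ , _ , q) , r = trans (cod-∈ r) (sym (cod-∈ q))

    groupoid : Groupoid (Carrier S)
    groupoid = record
      { category   = category
      ; invertible = λ a →
          let p = ∈nonempty {a}
              s = cod≡dom p (ᵒ⁺ p)
              t = cod≡dom (ᵒ⁺ p) p
          in a ᵒ , s , t , compose-≡ s p (ᵒ⁺ p) ∈block , compose-≡ t (ᵒ⁺ p) p ∈block
      }

    -- Comparison with the monoid in Rel

    open Groupoid groupoid using (multiplication; unit)

    ∇⇒multiplication : ∀ {ab c} → R {S ⊗ S} {S} ∇ ab c → multiplication ab c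
    ∇⇒multiplication μ with 0<#intermediate⇒Factors (fromℕ>0⇒0< μ)
    ... | _ , p , q = cod≡dom p q , compose-≡ (cod≡dom p q) p q ∈nonempty

    multiplication⇒∇ : ∀ {ab c} → multiplication ab c → R {S ⊗ S} {S} ∇ ab c
    multiplication⇒∇ (eq , refl) with compose-factors eq
    ... | _ , _ , f , r =
      -- The structure constant is evaluated at the pair picked by `nonempty`, so the factorisation
      -- is moved there within the block.
      0<⇒fromℕ>0 (Factors⇒0<#intermediate (Factors-resp r ∈nonempty f))

    -- Each positive constant gives a path over the chosen pair of its block. With the first path as
    -- reference, the pair of the second block lies in the first block too.
    ∇-functional : IsPartialFunction (R {S ⊗ S} {S} ∇)
    ∇-functional μ ν = disjoint (composite-unique p q ∈nonempty p′ q′) ∈nonempty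
      where
      f  = 0<#intermediate⇒Factors (fromℕ>0⇒0< μ)
      f′ = 0<#intermediate⇒Factors (fromℕ>0⇒0< ν)
      p  = proj₁ (proj₂ f)
      q  = proj₂ (proj₂ f)
      p′ = proj₁ (proj₂ f′)
      q′ = proj₂ (proj₂ f′)

    e⇒unit : ∀ {i a} → R {I} {S} e i a → unit i a
    e⇒unit {a = a} η = (a , indicator>0⇒True (⊆diagonal? a) η) , refl

    unit⇒e : ∀ {i a} → unit i a → R {I} {S} e i a
    unit⇒e ((a , t) , refl) = True⇒indicator>0 (⊆diagonal? a) t

corollary6p5 : (X : FinSet) (C : CoherentConfiguration X) →
    let open CoherentConfiguration C in
    Thin → IsGroupoid (Carrier S) (R {S ⊗ S} {S} ∇) (R {I} {S} e)
corollary6p5 X C thin =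
  (λ {ab} {c} {d} → ∇-functional {ab} {c} {d}) ,
  groupoid ,
  ((λ {ab} {c} → ∇⇒multiplication {ab} {c}) , λ {ab} {c} → multiplication⇒∇ {ab} {c}) ,
  ((λ {i} {a} → e⇒unit {i} {a}) , λ {i} {a} → unit⇒e {i} {a})
  where
  open Coherent C
  open ThinGroupoid thin
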